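{- Let $q$ be a prime power, let $\ell \geq 1$ and $n \geq 2\ell+1$ be integers, and put $k = n - \ell$. Let $f$ be a monic irreducible polynomial of degree $\ell$ over $\mathbb{F}_q$ with $\ell \times \ell$ companion matrix $M$, and let $\mathcal{C} = \mathrm{span}_{\mathbb{F}_q}(I, M, M^2, \ldots, M^{\ell-1}) \subseteq \mathbb{F}_q^{\ell \times \ell}$ (the matrix representation of $\mathbb{F}_{q^\ell}$ over $\mathbb{F}_q$), where $I$ is the $\ell \times \ell$ identity matrix. For a matrix $A$ write $[A]_1$ for its first column, and let $\mathbf{0}$ denote the $\ell \times (n-2\ell-1)$ zero matrix (empty if $n = 2\ell+1$). Define \[ \mathcal{G} = \bigl\{ \mathrm{rowspace}\,[\, I \mid A \mid [A^2]_1 \mid \mathbf{0}\,] : A \in \mathcal{C} \bigr\}, \] a family of subspaces of $\mathbb{F}_q^n$, and let $\mathcal{F} = \{ U^\perp : U \in \mathcal{G}\}$, where $U^\perp$ is the orthogonal complement of $U$ with respect to the standard bilinear form on $\mathbb{F}_q^n$. Then $\mathcal{F}$ is a family of $k$-dimensional subspaces of $\mathbb{F}_q^n$ of size $q^\ell = q^{n-k}$, and for every $s \geq 3$, $\mathcal{F}$ is set-like $s$-sunflower-free.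
   Context: A $k$-space means a $k$-dimensional subspace of $\mathbb{F}_q^n$. A family (a set, not a multiset) of $s$ distinct $k$-spaces $S_1, \ldots, S_s$ of $\mathbb{F}_q^n$ is a set-like $s$-sunflower with kernel $K$ if $K = S_i \cap S_j$ for all distinct $i, j$. A family of $k$-spaces is set-like $s$-sunflower-free if no $s$ of its members form a set-like $s$-sunflower. -}

module Defs where

open import Algebra.Bundles using (CommutativeRing; RawSemiring)
import Algebra.Definitions.RawSemiring as RawSemiringDefinitions
import Algebra.Properties.CommutativeMonoid.Sum as Sum
open import Data.Bool.Base using (if_then_else_)
open import Data.Fin.Base as Fin using (Fin; toℕ; fromℕ<)
import Data.Fin.Properties as Finₚ
open import Data.List.Base as List using (List; []; _∷_)
open import Data.Nat.Base as ℕ using (ℕ; zero; suc; _≤_; _<_; _≥_; _∸_)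
import Data.Nat.Primality as ℕ-Primality
import Data.Nat.Properties as ℕₚ
open import Data.Product.Base using (Σ; ∃-syntax; _×_; _,_; proj₁)
open import Data.Vec.Functional as Vector using (Vector; _++_)
import Data.Vec.Functional.Relation.Binary.Equality.Setoid as VectorEquality
open import Function.Bundles using (Inverse)
open import Level using (Level; _⊔_) renaming (suc to lsuc)
open import Relation.Binary.Bundles using (Setoid)
import Relation.Binary.Construct.On as On
open import Relation.Binary.PropositionalEquality as ≡ using (_≡_; _≢_)
open import Relation.Nullary.Decidable.Core using (does)
open import Relation.Nullary.Negation.Core using (¬_)
open import Relation.Unary using (Pred; _∈_; _⊆_; _∩_; _≐_)
open import Relation.Unary.Relation.Binary.Equality using (≐-setoid)

IsPrimePower : ℕ → Set
IsPrimePower q = ∃[ p ] ∃[ e ] ℕ-Primality.Prime p × 1 ≤ e × q ≡ p ℕ.^ e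

HasCardinality : ∀ {a b} → Setoid a b → ℕ → Set (a ⊔ b)
HasCardinality S m = Inverse S (≡.setoid (Fin m))

record Field c r : Set (lsuc (c ⊔ r)) where
  field
    commutativeRing : CommutativeRing c r

  open CommutativeRing commutativeRing public

  field
    1≉0     : ¬ (1# ≈ 0#)
    inverse : ∀ x → ¬ (x ≈ 0#) → ∃[ y ] x * y ≈ 1#

module OverField {c r : Level} (F : Field c r) where

  open Field F
  open Sum +-commutativeMonoid using (sum; sum-syntax; sum-cong-≋; ∑-distrib-+; sum-replicate-zero)
  open import Algebra.Properties.Semiring.Sum semiring using (*-distribˡ-sum)
  open VectorEquality setoid using (_≋_)
  open import Relation.Binary.Reasoning.Setoid setoid

  -- Coefficient lists, constant term first.  Trailing zeros are allowed,
  -- so equality of polynomials is equality of all coefficients.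
  Poly : Set c
  Poly = List Carrier

  coeff : Poly → ℕ → Carrier
  coeff []      _       = 0#
  coeff (a ∷ _) zero    = a
  coeff (_ ∷ f) (suc i) = coeff f i

  _≈ᴾ_ : Poly → Poly → Set r
  f ≈ᴾ g = ∀ i → coeff f i ≈ coeff g i

  _+ᴾ_ : Poly → Poly → Poly
  []      +ᴾ g       = g
  (a ∷ f) +ᴾ []      = a ∷ f
  (a ∷ f) +ᴾ (b ∷ g) = (a + b) ∷ (f +ᴾ g)

  _*ᴾ_ : Poly → Poly → Poly
  []      *ᴾ g = []
  (a ∷ f) *ᴾ g = List.map (a *_) g +ᴾ (0# ∷ (f *ᴾ g))

  polyRawSemiring : RawSemiring c r
  polyRawSemiring = record
    { Carrier = Poly
    ; _≈_     = _≈ᴾ_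
    ; _+_     = _+ᴾ_
    ; _*_     = _*ᴾ_
    ; 0#      = []
    ; 1#      = 1# ∷ []
    }

  open RawSemiringDefinitions polyRawSemiring public using (Irreducible)

  MonicOfDegree : ℕ → Poly → Set r
  MonicOfDegree d f = coeff f d ≈ 1# × (∀ i → d < i → coeff f i ≈ 0#)

  Matrix : ℕ → ℕ → Set c
  Matrix m n = Vector (Vector Carrier n) m

  _≈ᴹ_ : ∀ {m n} → Matrix m n → Matrix m n → Set r
  A ≈ᴹ B = ∀ i → A i ≋ B i

  Iᴹ : ∀ {n} → Matrix n n
  Iᴹ i j = if does (i Finₚ.≟ j) then 1# else 0#

  0ᴹ : ∀ {m n} → Matrix m n
  0ᴹ _ _ = 0#

  infixl 7 _*ᴹ_
  _*ᴹ_ : ∀ {l m n} → Matrix l m → Matrix m n → Matrix l n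
  _*ᴹ_ {m = m} A B i j = ∑[ t < m ] (A i t * B t j)

  infixr 8 _^ᴹ_
  _^ᴹ_ : ∀ {n} → Matrix n n → ℕ → Matrix n n
  A ^ᴹ zero  = Iᴹ
  A ^ᴹ suc t = A *ᴹ (A ^ᴹ t)

  infixr 5 _∣∣_
  _∣∣_ : ∀ {m a b} → Matrix m a → Matrix m b → Matrix m (a ℕ.+ b)
  (A ∣∣ B) i = A i ++ B i

  firstColumn : ∀ {m n} → 1 ≤ n → Matrix m n → Matrix m 1
  firstColumn 1≤n A i _ = A i (fromℕ< 1≤n)

  -- For f = x^d + c_{d-1} x^{d-1} + … + c_0: ones on the subdiagonal and
  -- last column (-c_0, …, -c_{d-1}).
  companion : (d : ℕ) → Poly → Matrix d d
  companion d f i j =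
    if does (suc (toℕ j) ℕₚ.≟ d) then - coeff f (toℕ i)
    else if does (toℕ i ℕₚ.≟ suc (toℕ j)) then 1#
    else 0#

  record Subspace (n : ℕ) : Set (lsuc (c ⊔ r)) where
    field
      Member  : Pred (Vector Carrier n) (c ⊔ r)
      resp    : ∀ {u v} → u ≋ v → Member u → Member v
      0-mem   : Member (λ _ → 0#)
      +-mem   : ∀ {u v} → Member u → Member v → Member (λ i → u i + v i)
      *-mem   : ∀ a {v} → Member v → Member (λ i → a * v i)

  open Subspace public using (Member)

  subspaceSetoid : ℕ → Setoid (lsuc (c ⊔ r)) (c ⊔ r)
  subspaceSetoid n = On.setoid (≐-setoid (Vector Carrier n) (c ⊔ r)) (Member {n})

  infix 4 _≐ˢ_
  _≐ˢ_ : ∀ {n} → Subspace n → Subspace n → Set (c ⊔ r)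
  U ≐ˢ V = Member U ≐ Member V

  linearCombination : ∀ {m n} → Vector Carrier m → Matrix m n → Vector Carrier n
  linearCombination {m} a B j = ∑[ i < m ] (a i * B i j)

  rowSpace : ∀ {m n} → Matrix m n → Subspace n
  rowSpace {m} {n} B = record
    { Member = λ v → ∃[ a ] v ≋ linearCombination a B
    ; resp   = λ u≋v (a , p) → a , λ j → trans (sym (u≋v j)) (p j)
    ; 0-mem  = (λ _ → 0#) , λ j → sym (trans (sum-cong-≋ (λ i → zeroˡ (B i j))) (sum-replicate-zero m))
    ; +-mem  = λ (a , p) (b , q) → (λ i → a i + b i) , λ j → begin
        _                                                   ≈⟨ +-cong (p j) (q j) ⟩
        linearCombination a B j + linearCombination b B j   ≈⟨ ∑-distrib-+ (λ i → a i * B i j) (λ i → b i * B i j) ⟨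
        ∑[ i < m ] (a i * B i j + b i * B i j)              ≈⟨ sum-cong-≋ (λ i → distribʳ (B i j) (a i) (b i)) ⟨
        linearCombination (λ i → a i + b i) B j             ∎
    ; *-mem  = λ x (a , p) → (λ i → x * a i) , λ j → begin
        _                                                   ≈⟨ *-congˡ (p j) ⟩
        x * linearCombination a B j                         ≈⟨ *-distribˡ-sum x (λ i → a i * B i j) ⟩
        ∑[ i < m ] (x * (a i * B i j))                      ≈⟨ sum-cong-≋ (λ i → *-assoc x (a i) (B i j)) ⟨
        linearCombination (λ i → x * a i) B j               ∎
    }

  LinearlyIndependent : ∀ {m n} → Matrix m n → Set (c ⊔ r)
  LinearlyIndependent B =
    ∀ a → linearCombination a B ≋ (λ _ → 0#) → a ≋ (λ _ → 0#)

  HasDimension : ∀ {n} → ℕ → Pred (Subspace n) (c ⊔ r)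
  HasDimension {n} k W =
    ∃[ B ] LinearlyIndependent {k} {n} B × W ≐ˢ rowSpace B

  ⟨_,_⟩ : ∀ {n} → Vector Carrier n → Vector Carrier n → Carrier
  ⟨_,_⟩ {n} u v = ∑[ i < n ] (u i * v i)

  infix 9 _⊥
  _⊥ : ∀ {n} → Subspace n → Subspace n
  _⊥ {n} U = record
    { Member = λ v → ∀ u → u ∈ Member U → ⟨ u , v ⟩ ≈ 0#
    ; resp   = λ v≋w p u u∈U → trans (sum-cong-≋ (λ i → *-congˡ (sym (v≋w i)))) (p u u∈U)
    ; 0-mem  = λ u _ → trans (sum-cong-≋ (λ i → zeroʳ (u i))) (sum-replicate-zero n)
    ; +-mem  = λ {v} {w} p q u u∈U → begin
        ⟨ u , (λ i → v i + w i) ⟩               ≈⟨ sum-cong-≋ (λ i → distribˡ (u i) (v i) (w i)) ⟩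
        ∑[ i < n ] (u i * v i + u i * w i)      ≈⟨ ∑-distrib-+ (λ i → u i * v i) (λ i → u i * w i) ⟩
        ⟨ u , v ⟩ + ⟨ u , w ⟩                   ≈⟨ +-cong (p u u∈U) (q u u∈U) ⟩
        0# + 0#                                 ≈⟨ +-identityˡ 0# ⟩
        0#                                      ∎
    ; *-mem  = λ x {v} p u u∈U → begin
        ⟨ u , (λ i → x * v i) ⟩                 ≈⟨ sum-cong-≋ (λ i → trans (sym (*-assoc (u i) x (v i)))
                                                     (trans (*-congʳ (*-comm (u i) x)) (*-assoc x (u i) (v i)))) ⟩
        ∑[ i < n ] (x * (u i * v i))            ≈⟨ *-distribˡ-sum x (λ i → u i * v i) ⟨
        x * ⟨ u , v ⟩                           ≈⟨ *-congˡ (p u u∈U) ⟩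
        x * 0#                                  ≈⟨ zeroʳ x ⟩
        0#                                      ∎
    }

  Family : ℕ → (b : Level) → Set (lsuc (c ⊔ r) ⊔ lsuc b)
  Family n b = Pred (Subspace n) b

  -- Members of a family are counted up to equality of subspaces.
  HasSize : ∀ {n b} → Family n b → ℕ → Set (lsuc (c ⊔ r) ⊔ b)
  HasSize {n} 𝓐 = HasCardinality (On.setoid (subspaceSetoid n) (proj₁ {B = 𝓐}))

  record IsSetLikeSunflower {n} (k s : ℕ) (S : Vector (Subspace n) s) (K : Subspace n)
         : Set (c ⊔ r) where
    field
      dimension : ∀ i → HasDimension k (S i)
      distinct  : ∀ i j → i ≢ j → ¬ (S i ≐ˢ S j)
      kernel    : ∀ i j → i ≢ j → Member K ≐ Member (S i) ∩ Member (S j)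

  SetLikeSunflowerFree : ∀ {n b} (k s : ℕ) → Family n b → Set (lsuc (c ⊔ r) ⊔ b)
  SetLikeSunflowerFree {n} k s 𝓐 =
    ¬ (∃[ S ] (∀ i → S i ∈ 𝓐) × (∃[ K ] IsSetLikeSunflower {n} k s S K))

  -- span(I, M, …, M^{ℓ-1}) for the companion matrix M of f
  𝒞 : (ℓ : ℕ) → Poly → Pred (Matrix ℓ ℓ) (c ⊔ r)
  𝒞 ℓ f A = Σ (Vector Carrier ℓ) λ a →
    A ≈ᴹ λ i j → ∑[ t < ℓ ] (a t * (companion ℓ f ^ᴹ toℕ t) i j)

  blockWidths : ∀ ℓ n → n ≥ 2 ℕ.* ℓ ℕ.+ 1 →
                n ≡ ℓ ℕ.+ (ℓ ℕ.+ (1 ℕ.+ (n ∸ (2 ℕ.* ℓ ℕ.+ 1))))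
  blockWidths ℓ n n≥ = ≡R.begin
    n                                             ≡R.≡⟨ ℕₚ.m+[n∸m]≡n n≥ ⟨
    2 ℕ.* ℓ ℕ.+ 1 ℕ.+ z                           ≡R.≡⟨ ℕₚ.+-assoc (2 ℕ.* ℓ) 1 z ⟩
    ℓ ℕ.+ (ℓ ℕ.+ 0) ℕ.+ (1 ℕ.+ z)                 ≡R.≡⟨ ≡.cong (λ m → ℓ ℕ.+ m ℕ.+ (1 ℕ.+ z)) (ℕₚ.+-identityʳ ℓ) ⟩
    ℓ ℕ.+ ℓ ℕ.+ (1 ℕ.+ z)                         ≡R.≡⟨ ℕₚ.+-assoc ℓ ℓ (1 ℕ.+ z) ⟩
    ℓ ℕ.+ (ℓ ℕ.+ (1 ℕ.+ z))                       ≡R.∎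
    where
    module ≡R = ≡.≡-Reasoning
    z = n ∸ (2 ℕ.* ℓ ℕ.+ 1)

  -- [ I ∣ A ∣ [A²]₁ ∣ 0 ], its columns reindexed by Fin n
  generator : ∀ {ℓ n} → 1 ≤ ℓ → n ≥ 2 ℕ.* ℓ ℕ.+ 1 → Matrix ℓ ℓ → Matrix ℓ n
  generator {ℓ} {n} 1≤ℓ n≥ A i j =
    (Iᴹ ∣∣ A ∣∣ firstColumn 1≤ℓ (A *ᴹ A) ∣∣ 0ᴹ) i (Fin.cast (blockWidths ℓ n n≥) j)

  𝒢 : ∀ {ℓ n} → 1 ≤ ℓ → n ≥ 2 ℕ.* ℓ ℕ.+ 1 → Poly → Family n (c ⊔ r)
  𝒢 {ℓ} 1≤ℓ n≥ f U = ∃[ A ] A ∈ 𝒞 ℓ f × U ≐ˢ rowSpace (generator 1≤ℓ n≥ A)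

  ℱ : ∀ {ℓ n} → 1 ≤ ℓ → n ≥ 2 ℕ.* ℓ ℕ.+ 1 → Poly → Family n (lsuc (c ⊔ r))
  ℱ 1≤ℓ n≥ f W = ∃[ U ] U ∈ 𝒢 1≤ℓ n≥ f × W ≐ˢ U ⊥

{-# OPTIONS --safe #-}
module Submission where

-- With e₀ the first standard basis vector, U_A^⊥ is the set of (x, y, z, w) with
-- x + A y + z A² e₀ = 0.  Hence
-- (AB e₀, -(A + B) e₀, 1, 0) lies in U_A^⊥ ∩ U_B^⊥; if it also lies in U_C^⊥, as
-- it must when the three form a sunflower, then (C - A)(C - B) e₀ = 0.  Since e₀
-- is a cyclic vector of M whose annihilator is the irreducible f, this forces
-- C = A or C = B.

open import Defs
open import Algebra.Bundles using (RawSemiring)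
import Algebra.Definitions.RawMagma as RawMagmaDefinitions
import Algebra.Definitions.RawSemiring as RawSemiringDefinitions
import Algebra.Properties.AbelianGroup as AbelianGroupProperties
import Algebra.Properties.CommutativeSemigroup as CommutativeSemigroupProperties
import Algebra.Properties.Ring as RingProperties
import Algebra.Properties.Semiring.Sum as SemiringSum
import Algebra.Solver.CommutativeMonoid as CommutativeMonoidSolver
open import Data.Bool.Base using (if_then_else_)
open import Data.Empty using (⊥-elim)
open import Data.Fin.Base as Fin using (Fin; zero; suc; toℕ; fromℕ; fromℕ<; inject₁; _↑ˡ_; _↑ʳ_)
open import Data.Fin.Patterns using (0F; 1F; 2F)
import Data.Fin.Properties as Finₚ
open import Data.List.Base as List using ([]; _∷_)
open import Data.Nat.Base using (ℕ; zero; suc; _≤_; _≥_; z≤n; s≤s; _+_; _*_; _∸_; _^_)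
import Data.Nat.Properties as ℕₚ
open import Data.Product.Base using (_×_; _,_; ∃-syntax; proj₁; proj₂)
open import Data.Sum.Base as Sum using (inj₁; inj₂; _⊎_; [_,_]′)
open import Data.Vec.Functional using (Vector; _++_)
open import Data.Vec.Functional.Properties using (lookup-++ˡ; lookup-++ʳ)
import Data.Vec.Functional.Relation.Binary.Equality.Setoid as VectorEquality
open import Function.Base using (_∘_)
open import Function.Bundles using (Inverse)
open import Function.Properties.Inverse using (Inverse⇒Injection)
open import Level using (Level; _⊔_) renaming (suc to lsuc)
open import Relation.Binary.Definitions using (Decidable)
open import Relation.Binary.PropositionalEquality as ≡ using (_≡_; _≗_)
open import Relation.Nullary.Decidable using (yes; no; does; dec-true; dec-false; via-injection)
open import Relation.Nullary.Negation using (¬_)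
open import Relation.Unary using (Pred; _⊆_; _∈_; _≐_)
open import Relation.Unary.Properties using (≐-refl)

-- The point comes from Vieta: the equation of a third member C at it is T² - (A + B) T + AB
-- evaluated at T = C and applied to e₀, so A and B are roots by construction. The column `[A²]₁` is
-- what makes the equation quadratic. With `[ I ∣ A ∣ 0 ]` alone, any two distinct complements would
-- meet exactly in x = y = 0, and the whole family would be a sunflower. One column can carry A²
-- because an element of `𝒞` is determined by its value at e₀. The field with q^ℓ elements is never
-- formed. A matrix of `𝒞` is handled through its coefficient vector a, read as a polynomial of
-- degree below ℓ acting on vectors. The companion matrix makes A e₀ equal to a itself, so vanishing
-- at e₀ is vanishing of coefficients. The same fact recovers a from the subspace, which gives the
-- size q^ℓ.

funToFin-cong : ∀ {m n} {g h : Fin m → Fin n} → g ≗ h → Fin.funToFin g ≡ Fin.funToFin h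
funToFin-cong {zero}  g≗h = ≡.refl
funToFin-cong {suc m} g≗h = ≡.cong₂ Fin.combine (g≗h zero) (funToFin-cong (g≗h ∘ suc))

module LinearAlgebra {c r : Level} (F : Field c r) where

  open Field F hiding (zero) renaming (_+_ to _+F_; _*_ to _*F_; _-_ to _-F_)
  open OverField F
  open SemiringSum semiring
  open RawMagmaDefinitions (RawSemiring.*-rawMagma polyRawSemiring) using (_,_) renaming (_∣_ to _∣ᴾ_)
  open VectorEquality setoid using (_≋_)
  open RingProperties ring using (-‿distribʳ-*; -1*x≈-x)
  open AbelianGroupProperties +-abelianGroup using (⁻¹-∙-comm; ⁻¹-anti-homo‿-; inverseˡ-unique; x∙y⁻¹≈ε⇒x≈y)
  open CommutativeSemigroupProperties +-commutativeSemigroup using (interchange; x∙yz≈y∙xz)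
  open CommutativeSemigroupProperties *-commutativeSemigroup
    using () renaming (x∙yz≈y∙xz to x*yz≈y*xz)
  open import Relation.Binary.Reasoning.Setoid setoid

  -- Vectors, finite sums and the bilinear form.

  infixl 6 _+ᵛ_
  infixr 7 _·ᵛ_ _*ᵛ_

  0ᵛ : ∀ {n} → Vector Carrier n
  0ᵛ _ = 0#

  _+ᵛ_ : ∀ {n} → Vector Carrier n → Vector Carrier n → Vector Carrier n
  (u +ᵛ v) i = u i +F v i

  _·ᵛ_ : ∀ {n} → Carrier → Vector Carrier n → Vector Carrier n
  (x ·ᵛ v) i = x *F v i

  _*ᵛ_ : ∀ {m n} → Matrix m n → Vector Carrier n → Vector Carrier m
  (A *ᵛ v) i = ⟨ A i , v ⟩

  sum-zero : ∀ {n} (v : Vector Carrier n) → v ≋ 0ᵛ → sum v ≈ 0#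
  sum-zero {n} v v≋0 = trans (sum-cong-≋ v≋0) (sum-replicate-zero n)

  sum-++ : ∀ m {n} (v : Vector Carrier (m + n)) →
           sum v ≈ sum (v ∘ (_↑ˡ n)) +F sum (v ∘ (m ↑ʳ_))
  sum-++ zero    v = sym (+-identityˡ _)
  sum-++ (suc m) v = trans (+-congˡ (sum-++ m (v ∘ suc))) (sym (+-assoc _ _ _))

  sum-cast : ∀ {m n} (eq : m ≡ n) (v : Vector Carrier m) →
             sum v ≈ sum (v ∘ Fin.cast (≡.sym eq))
  sum-cast ≡.refl v = sum-cong-≋ λ i → reflexive (≡.cong v (≡.sym (Finₚ.cast-is-id ≡.refl i)))

  ⟨⟩-congʳ : ∀ {n} (u : Vector Carrier n) {v w} → v ≋ w → ⟨ u , v ⟩ ≈ ⟨ u , w ⟩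
  ⟨⟩-congʳ u v≋w = sum-cong-≋ λ i → *-congˡ (v≋w i)

  ⟨⟩-congˡ : ∀ {n} {u u′ : Vector Carrier n} v → u ≋ u′ → ⟨ u , v ⟩ ≈ ⟨ u′ , v ⟩
  ⟨⟩-congˡ v u≋u′ = sum-cong-≋ λ i → *-congʳ (u≋u′ i)

  ⟨⟩-zeroʳ : ∀ {n} (u : Vector Carrier n) → ⟨ u , 0ᵛ ⟩ ≈ 0#
  ⟨⟩-zeroʳ u = sum-zero _ λ i → zeroʳ (u i)

  ⟨⟩-+ʳ : ∀ {n} (u v w : Vector Carrier n) → ⟨ u , v +ᵛ w ⟩ ≈ ⟨ u , v ⟩ +F ⟨ u , w ⟩
  ⟨⟩-+ʳ u v w = trans (sum-cong-≋ λ i → distribˡ (u i) (v i) (w i))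
                         (∑-distrib-+ (λ i → u i *F v i) (λ i → u i *F w i))

  ⟨⟩-·ʳ : ∀ {n} (u : Vector Carrier n) x v → ⟨ u , x ·ᵛ v ⟩ ≈ x *F ⟨ u , v ⟩
  ⟨⟩-·ʳ u x v = trans (sum-cong-≋ λ i → x*yz≈y*xz (u i) x (v i)) (sym (*-distribˡ-sum x λ i → u i *F v i))

  -- Associativity (u B) v = u (B v), by exchanging the two sums. It serves for members of a row
  -- space and, with `B` a power of a matrix, for matrix products applied to a vector.
  ⟨⟩-∑ˡ : ∀ {m n} (u : Vector Carrier m) (B : Matrix m n) (v : Vector Carrier n) →
          ⟨ linearCombination u B , v ⟩ ≈ ⟨ u , B *ᵛ v ⟩
  ⟨⟩-∑ˡ u B v = begin
    sum (λ j → linearCombination u B j *F v j)        ≈⟨ sum-cong-≋ (λ j → *-distribʳ-sum (v j) λ i → u i *F B i j) ⟩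
    sum (λ j → sum (λ i → (u i *F B i j) *F v j))     ≈⟨ ∑-comm (λ j i → (u i *F B i j) *F v j) ⟩
    sum (λ i → sum (λ j → (u i *F B i j) *F v j))     ≈⟨ sum-cong-≋ (λ i → sum-cong-≋ λ j → *-assoc (u i) (B i j) (v j)) ⟩
    sum (λ i → sum (λ j → u i *F (B i j *F v j)))     ≈⟨ sum-cong-≋ (λ i → *-distribˡ-sum (u i) λ j → B i j *F v j) ⟨
    ⟨ u , B *ᵛ v ⟩                                    ∎

  ⟨Iᴹ,⟩ : ∀ {n} (v : Vector Carrier n) i → ⟨ Iᴹ i , v ⟩ ≈ v i
  ⟨Iᴹ,⟩ {suc n} v zero = begin
    1# *F v zero +F _   ≈⟨ +-cong (*-identityˡ _) (sum-zero _ λ j → zeroˡ (v (suc j))) ⟩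
    v zero +F 0#        ≈⟨ +-identityʳ _ ⟩
    v zero              ∎
  ⟨Iᴹ,⟩ {suc n} v (suc i) = begin
    0# *F v zero +F _   ≈⟨ +-cong (zeroˡ _) (⟨Iᴹ,⟩ (v ∘ suc) i) ⟩
    0# +F v (suc i)     ≈⟨ +-identityˡ _ ⟩
    v (suc i)           ∎

  Iᴹ-sym : ∀ {n} (i j : Fin n) → Iᴹ i j ≈ Iᴹ j i
  Iᴹ-sym zero    zero    = refl
  Iᴹ-sym zero    (suc j) = refl
  Iᴹ-sym (suc i) zero    = refl
  Iᴹ-sym (suc i) (suc j) = Iᴹ-sym i j

  ⟨,Iᴹ⟩ : ∀ {n} (v : Vector Carrier n) i → ⟨ v , (λ j → Iᴹ j i) ⟩ ≈ v i
  ⟨,Iᴹ⟩ v i = trans (sum-cong-≋ λ j → trans (*-comm _ _) (*-congʳ (Iᴹ-sym j i))) (⟨Iᴹ,⟩ v i)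

  -- Polynomials: coefficients, degree bounds and division.

  coeff-+ᴾ : ∀ p q i → coeff (p +ᴾ q) i ≈ coeff p i +F coeff q i
  coeff-+ᴾ []      q       i       = sym (+-identityˡ _)
  coeff-+ᴾ (a ∷ p) []      i       = sym (+-identityʳ _)
  coeff-+ᴾ (a ∷ p) (b ∷ q) zero    = refl
  coeff-+ᴾ (a ∷ p) (b ∷ q) (suc i) = coeff-+ᴾ p q i

  coeff-map : ∀ x p i → coeff (List.map (x *F_) p) i ≈ x *F coeff p i
  coeff-map x []      i       = sym (zeroʳ x)
  coeff-map x (a ∷ p) zero    = refl
  coeff-map x (a ∷ p) (suc i) = coeff-map x p i

  coeff-tabulate : ∀ {n} (a : Vector Carrier n) t → coeff (List.tabulate a) (toℕ t) ≈ a t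
  coeff-tabulate a zero    = refl
  coeff-tabulate a (suc t) = coeff-tabulate (a ∘ suc) t

  tabulate-cong : ∀ {n} {a b : Vector Carrier n} → a ≋ b → List.tabulate a ≈ᴾ List.tabulate b
  tabulate-cong {zero}  a≋b i       = refl
  tabulate-cong {suc n} a≋b zero    = a≋b zero
  tabulate-cong {suc n} a≋b (suc i) = tabulate-cong (a≋b ∘ suc) i

  -- A bound instead of a degree: lists may end in zeros, so their length does not give the degree.
  -- The bound 0 singles out the zero polynomial.
  DegreeBelow : ℕ → Poly → Set r
  DegreeBelow d p = ∀ i → d ≤ i → coeff p i ≈ 0#

  tabulate-degreeBelow : ∀ {n} (a : Vector Carrier n) → DegreeBelow n (List.tabulate a)
  tabulate-degreeBelow {zero}  a i       n≤i       = refl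
  tabulate-degreeBelow {suc n} a (suc i) (s≤s n≤i) = tabulate-degreeBelow (a ∘ suc) i n≤i

  degreeBelow-pred : ∀ {d p} → DegreeBelow (suc d) p → coeff p d ≈ 0# → DegreeBelow d p
  degreeBelow-pred deg pd≈0 i d≤i with ℕₚ.m≤n⇒m<n∨m≡n d≤i
  ... | inj₁ d<i    = deg i d<i
  ... | inj₂ ≡.refl = pd≈0

  infixl 6 _-ᴾ_
  _-ᴾ_ : Poly → Poly → Poly
  p -ᴾ q = p +ᴾ List.map (- 1# *F_) q

  coeff--ᴾ : ∀ p q i → coeff (p -ᴾ q) i ≈ coeff p i -F coeff q i
  coeff--ᴾ p q i = begin
    coeff (p -ᴾ q) i                                       ≈⟨ coeff-+ᴾ p _ i ⟩
    coeff p i +F coeff (List.map (- 1# *F_) q) i           ≈⟨ +-congˡ (coeff-map (- 1#) q i) ⟩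
    coeff p i +F - 1# *F coeff q i                         ≈⟨ +-congˡ (-1*x≈-x _) ⟩
    coeff p i -F coeff q i                                 ∎

  -ᴾ-degreeBelow : ∀ {d} p q → DegreeBelow d p → DegreeBelow d q → DegreeBelow d (p -ᴾ q)
  -ᴾ-degreeBelow p q p< q< i d≤i = begin
    coeff (p -ᴾ q) i          ≈⟨ coeff--ᴾ p q i ⟩
    coeff p i -F coeff q i    ≈⟨ +-cong (p< i d≤i) (-‿cong (q< i d≤i)) ⟩
    0# -F 0#                  ≈⟨ -‿inverseʳ 0# ⟩
    0#                        ∎

  -- If p = s g + t, then a + X p = X s g + (a + X t), and a + X t has degree at most d, so
  -- subtracting one multiple of g brings it below d. This fits lists that start with the constant
  -- term.
  divide : ∀ {d} g → DegreeBelow (suc d) g → ¬ (coeff g d ≈ 0#) →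
           ∀ p → ∃[ s ] ∃[ t ] DegreeBelow d t × p ≈ᴾ ((s *ᴾ g) +ᴾ t)
  divide g deg lead [] = [] , [] , (λ _ _ → refl) , λ _ → refl
  divide {d} g deg lead (a ∷ p) with divide g deg lead p | inverse (coeff g d) lead
  ... | s , t , t< , p≈ | y , gy≈1 = x ∷ s , t′ , t′< , eq
    where
    -- `y` inverts the leading coefficient of `g`, so `x` times `g` cancels coefficient `d` of
    -- `a ∷ t`.
    x  = coeff (a ∷ t) d *F y
    u  = List.map (x *F_) g
    t′ = (a ∷ t) -ᴾ u

    t′-coeff : ∀ i → coeff t′ i ≈ coeff (a ∷ t) i -F x *F coeff g i
    t′-coeff i = trans (coeff--ᴾ (a ∷ t) u i) (+-congˡ (-‿cong (coeff-map x g i)))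

    xg≈ : x *F coeff g d ≈ coeff (a ∷ t) d
    xg≈ = begin
      coeff (a ∷ t) d *F y *F coeff g d     ≈⟨ *-assoc _ _ _ ⟩
      coeff (a ∷ t) d *F (y *F coeff g d)   ≈⟨ *-congˡ (trans (*-comm _ _) gy≈1) ⟩
      coeff (a ∷ t) d *F 1#                 ≈⟨ *-identityʳ _ ⟩
      coeff (a ∷ t) d                       ∎

    t′≤ : DegreeBelow (suc d) t′
    t′≤ (suc i) (s≤s d≤i) = begin
      coeff t′ (suc i)                          ≈⟨ t′-coeff (suc i) ⟩
      coeff t i -F x *F coeff g (suc i)         ≈⟨ +-cong (t< i d≤i) (-‿cong (*-congˡ (deg (suc i) (s≤s d≤i)))) ⟩
      0# -F x *F 0#                             ≈⟨ +-congˡ (-‿cong (zeroʳ x)) ⟩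
      0# -F 0#                                  ≈⟨ -‿inverseʳ 0# ⟩
      0#                                        ∎

    t′< : DegreeBelow d t′
    t′< = degreeBelow-pred {p = t′} t′≤ (begin
      coeff t′ d                                ≈⟨ t′-coeff d ⟩
      coeff (a ∷ t) d -F x *F coeff g d         ≈⟨ +-congˡ (-‿cong xg≈) ⟩
      coeff (a ∷ t) d -F coeff (a ∷ t) d        ≈⟨ -‿inverseʳ _ ⟩
      0#                                        ∎)

    shifted : ∀ i → coeff (a ∷ p) i ≈ coeff (0# ∷ (s *ᴾ g)) i +F coeff (a ∷ t) i
    shifted zero    = sym (+-identityˡ a)
    shifted (suc i) = trans (p≈ i) (coeff-+ᴾ (s *ᴾ g) t i)

    eq : (a ∷ p) ≈ᴾ (((x ∷ s) *ᴾ g) +ᴾ t′)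
    eq i = begin
      coeff (a ∷ p) i                                                  ≈⟨ shifted i ⟩
      S +F A                                                           ≈⟨ +-congˡ (+-identityʳ A) ⟨
      S +F (A +F 0#)                                                   ≈⟨ +-congˡ (+-congˡ (-‿inverseʳ X)) ⟨
      S +F (A +F (X -F X))                                             ≈⟨ +-congˡ (x∙yz≈y∙xz A X (- X)) ⟩
      S +F (X +F (A -F X))                                             ≈⟨ x∙yz≈y∙xz S X _ ⟩
      X +F (S +F (A -F X))                                             ≈⟨ +-assoc X S _ ⟨
      X +F S +F (A -F X)                                               ≈⟨ +-cong (+-congʳ (coeff-map x g i)) (t′-coeff i) ⟨
      coeff u i +F S +F coeff t′ i                                     ≈⟨ +-congʳ (coeff-+ᴾ u _ i) ⟨
      coeff ((x ∷ s) *ᴾ g) i +F coeff t′ i                             ≈⟨ coeff-+ᴾ ((x ∷ s) *ᴾ g) t′ i ⟨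
      coeff (((x ∷ s) *ᴾ g) +ᴾ t′) i                                   ∎
      where
      S = coeff (0# ∷ (s *ᴾ g)) i
      A = coeff (a ∷ t) i
      X = x *F coeff g i

  -- Polynomials in a matrix acting on vectors.

  -- p(M) v, by Horner's rule.
  act : ∀ {n} → Matrix n n → Poly → Vector Carrier n → Vector Carrier n
  act M []      v = 0ᵛ
  act M (a ∷ p) v = a ·ᵛ v +ᵛ M *ᵛ act M p v

  module Action {n} (M : Matrix n n) where

    act-congʳ : ∀ p {v w} → v ≋ w → act M p v ≋ act M p w
    act-congʳ []      v≋w i = refl
    act-congʳ (a ∷ p) v≋w i = +-cong (*-congˡ (v≋w i)) (⟨⟩-congʳ (M i) (act-congʳ p v≋w))

    act-vanishing : ∀ p v → (∀ i → coeff p i ≈ 0#) → act M p v ≋ 0ᵛ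
    act-vanishing []      v p≈0 i = refl
    act-vanishing (a ∷ p) v p≈0 i = begin
      a *F v i +F ⟨ M i , act M p v ⟩   ≈⟨ +-cong (*-congʳ (p≈0 0)) (⟨⟩-congʳ (M i) (act-vanishing p v (p≈0 ∘ suc))) ⟩
      0# *F v i +F ⟨ M i , 0ᵛ ⟩         ≈⟨ +-cong (zeroˡ (v i)) (⟨⟩-zeroʳ (M i)) ⟩
      0# +F 0#                          ≈⟨ +-identityˡ 0# ⟩
      0#                                ∎

    -- Equal polynomials may be lists of different lengths; the excess consists of zeros and is
    -- absorbed by `act-vanishing`.
    act-congˡ : ∀ p q v → p ≈ᴾ q → act M p v ≋ act M q v
    act-congˡ []      q       v p≈q i = sym (act-vanishing q v (sym ∘ p≈q) i)
    act-congˡ (a ∷ p) []      v p≈q i = act-vanishing (a ∷ p) v p≈q i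
    act-congˡ (a ∷ p) (b ∷ q) v p≈q i =
      +-cong (*-congʳ (p≈q 0)) (⟨⟩-congʳ (M i) (act-congˡ p q v (p≈q ∘ suc)))

    act-0ᵛ : ∀ p → act M p 0ᵛ ≋ 0ᵛ
    act-0ᵛ []      i = refl
    act-0ᵛ (a ∷ p) i = begin
      a *F 0# +F ⟨ M i , act M p 0ᵛ ⟩   ≈⟨ +-cong (zeroʳ a) (⟨⟩-congʳ (M i) (act-0ᵛ p)) ⟩
      0# +F ⟨ M i , 0ᵛ ⟩                ≈⟨ +-identityˡ _ ⟩
      ⟨ M i , 0ᵛ ⟩                      ≈⟨ ⟨⟩-zeroʳ (M i) ⟩
      0#                                ∎

    act-+ᵛ : ∀ p v w → act M p (v +ᵛ w) ≋ act M p v +ᵛ act M p w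
    act-+ᵛ []      v w i = sym (+-identityˡ 0#)
    act-+ᵛ (a ∷ p) v w i = begin
      a *F (v i +F w i) +F ⟨ M i , act M p (v +ᵛ w) ⟩
        ≈⟨ +-cong (distribˡ a (v i) (w i)) (trans (⟨⟩-congʳ (M i) (act-+ᵛ p v w)) (⟨⟩-+ʳ (M i) _ _)) ⟩
      (a *F v i +F a *F w i) +F (⟨ M i , act M p v ⟩ +F ⟨ M i , act M p w ⟩)
        ≈⟨ interchange _ _ _ _ ⟩
      act M (a ∷ p) v i +F act M (a ∷ p) w i ∎

    act-·ᵛ : ∀ p x v → act M p (x ·ᵛ v) ≋ x ·ᵛ act M p v
    act-·ᵛ []      x v i = sym (zeroʳ x)
    act-·ᵛ (a ∷ p) x v i = begin
      a *F (x *F v i) +F ⟨ M i , act M p (x ·ᵛ v) ⟩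
        ≈⟨ +-cong (x*yz≈y*xz a x (v i)) (trans (⟨⟩-congʳ (M i) (act-·ᵛ p x v)) (⟨⟩-·ʳ (M i) x _)) ⟩
      x *F (a *F v i) +F x *F ⟨ M i , act M p v ⟩
        ≈⟨ distribˡ x _ _ ⟨
      x *F act M (a ∷ p) v i ∎

    act-*ᵛ : ∀ p v → act M p (M *ᵛ v) ≋ M *ᵛ act M p v
    act-*ᵛ []      v i = sym (⟨⟩-zeroʳ (M i))
    act-*ᵛ (a ∷ p) v i = begin
      a *F ⟨ M i , v ⟩ +F ⟨ M i , act M p (M *ᵛ v) ⟩       ≈⟨ +-cong (sym (⟨⟩-·ʳ (M i) a v)) (⟨⟩-congʳ (M i) (act-*ᵛ p v)) ⟩
      ⟨ M i , a ·ᵛ v ⟩ +F ⟨ M i , M *ᵛ act M p v ⟩         ≈⟨ ⟨⟩-+ʳ (M i) _ _ ⟨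
      ⟨ M i , act M (a ∷ p) v ⟩                            ∎

    -- Both factors are polynomials in the same `M`: `act M q` is linear and commutes with `M`, so
    -- induction on `p` applies. This is the commutativity of `𝒞`, stated on vectors.
    act-comm : ∀ p q v → act M p (act M q v) ≋ act M q (act M p v)
    act-comm []      q v i = sym (act-0ᵛ q i)
    act-comm (a ∷ p) q v i = begin
      a *F act M q v i +F ⟨ M i , act M p (act M q v) ⟩
        ≈⟨ +-cong (sym (act-·ᵛ q a v i)) (⟨⟩-congʳ (M i) (act-comm p q v)) ⟩
      act M q (a ·ᵛ v) i +F ⟨ M i , act M q (act M p v) ⟩
        ≈⟨ +-congˡ (act-*ᵛ q (act M p v) i) ⟨
      act M q (a ·ᵛ v) i +F act M q (M *ᵛ act M p v) i
        ≈⟨ act-+ᵛ q _ _ i ⟨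
      act M q (act M (a ∷ p) v) i ∎

    act-+ᴾ : ∀ p q v → act M (p +ᴾ q) v ≋ act M p v +ᵛ act M q v
    act-+ᴾ []      q       v i = sym (+-identityˡ _)
    act-+ᴾ (a ∷ p) []      v i = sym (+-identityʳ _)
    act-+ᴾ (a ∷ p) (b ∷ q) v i = begin
      (a +F b) *F v i +F ⟨ M i , act M (p +ᴾ q) v ⟩
        ≈⟨ +-cong (distribʳ (v i) a b) (trans (⟨⟩-congʳ (M i) (act-+ᴾ p q v)) (⟨⟩-+ʳ (M i) _ _)) ⟩
      (a *F v i +F b *F v i) +F (⟨ M i , act M p v ⟩ +F ⟨ M i , act M q v ⟩)
        ≈⟨ interchange _ _ _ _ ⟩
      act M (a ∷ p) v i +F act M (b ∷ q) v i ∎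

    act-map : ∀ x p v → act M (List.map (x *F_) p) v ≋ x ·ᵛ act M p v
    act-map x []      v i = sym (zeroʳ x)
    act-map x (a ∷ p) v i = begin
      (x *F a) *F v i +F ⟨ M i , act M (List.map (x *F_) p) v ⟩
        ≈⟨ +-cong (*-assoc x a (v i)) (trans (⟨⟩-congʳ (M i) (act-map x p v)) (⟨⟩-·ʳ (M i) x _)) ⟩
      x *F (a *F v i) +F x *F ⟨ M i , act M p v ⟩
        ≈⟨ distribˡ x _ _ ⟨
      x *F act M (a ∷ p) v i ∎

    act-*ᴾ : ∀ p q v → act M (p *ᴾ q) v ≋ act M p (act M q v)
    act-*ᴾ []      q v i = refl
    act-*ᴾ (a ∷ p) q v i = begin
      act M (List.map (a *F_) q +ᴾ (0# ∷ (p *ᴾ q))) v i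
        ≈⟨ act-+ᴾ (List.map (a *F_) q) _ v i ⟩
      act M (List.map (a *F_) q) v i +F (0# *F v i +F ⟨ M i , act M (p *ᴾ q) v ⟩)
        ≈⟨ +-cong (act-map a q v i) (trans (+-congʳ (zeroˡ (v i))) (+-identityˡ _)) ⟩
      a *F act M q v i +F ⟨ M i , act M (p *ᴾ q) v ⟩
        ≈⟨ +-congˡ (⟨⟩-congʳ (M i) (act-*ᴾ p q v)) ⟩
      act M (a ∷ p) (act M q v) i ∎

    act--ᴾ : ∀ p q v i → act M (p -ᴾ q) v i ≈ act M p v i -F act M q v i
    act--ᴾ p q v i = begin
      act M (p -ᴾ q) v i                                        ≈⟨ act-+ᴾ p _ v i ⟩
      act M p v i +F act M (List.map (- 1# *F_) q) v i          ≈⟨ +-congˡ (act-map (- 1#) q v i) ⟩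
      act M p v i +F - 1# *F act M q v i                        ≈⟨ +-congˡ (-1*x≈-x _) ⟩
      act M p v i -F act M q v i                                ∎

    act-1ᴾ : ∀ v → act M (1# ∷ []) v ≋ v
    act-1ᴾ v i = trans (+-cong (*-identityˡ (v i)) (⟨⟩-zeroʳ (M i))) (+-identityʳ (v i))

    -- Reconciles Horner's rule with the sums of powers of `M` that define `𝒞`.
    act-tabulate : ∀ {m} (a : Vector Carrier m) v i →
                   act M (List.tabulate a) v i ≈ sum (λ t → a t *F ((M ^ᴹ toℕ t) *ᵛ v) i)
    act-tabulate {zero}  a v i = refl
    act-tabulate {suc m} a v i = +-cong (*-congˡ (sym (⟨Iᴹ,⟩ v i))) (begin
      ⟨ M i , act M (List.tabulate (a ∘ suc)) v ⟩
        ≈⟨ ⟨⟩-congʳ (M i) (act-tabulate (a ∘ suc) v) ⟩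
      sum (λ j → M i j *F sum (λ t → a (suc t) *F ((M ^ᴹ toℕ t) *ᵛ v) j))
        ≈⟨ sum-cong-≋ (λ j → trans (*-distribˡ-sum (M i j) (λ t → a (suc t) *F ((M ^ᴹ toℕ t) *ᵛ v) j))
             (sum-cong-≋ λ t → x*yz≈y*xz (M i j) (a (suc t)) (((M ^ᴹ toℕ t) *ᵛ v) j))) ⟩
      sum (λ j → sum (λ t → a (suc t) *F (M i j *F ((M ^ᴹ toℕ t) *ᵛ v) j)))
        ≈⟨ ∑-comm (λ j t → a (suc t) *F (M i j *F ((M ^ᴹ toℕ t) *ᵛ v) j)) ⟩
      sum (λ t → sum (λ j → a (suc t) *F (M i j *F ((M ^ᴹ toℕ t) *ᵛ v) j)))
        ≈⟨ sum-cong-≋ (λ t → trans (sym (*-distribˡ-sum (a (suc t)) λ j → M i j *F ((M ^ᴹ toℕ t) *ᵛ v) j))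
             (*-congˡ (sym (⟨⟩-∑ˡ (M i) (M ^ᴹ toℕ t) v)))) ⟩
      sum (λ t → a (suc t) *F ((M ^ᴹ suc (toℕ t)) *ᵛ v) i) ∎)

    span-*ᵛ : ∀ {m} (a : Vector Carrier m) v →
              (λ i j → sum (λ t → a t *F (M ^ᴹ toℕ t) i j)) *ᵛ v ≋ act M (List.tabulate a) v
    span-*ᵛ a v i = trans (⟨⟩-∑ˡ a (λ t → (M ^ᴹ toℕ t) i) v) (sym (act-tabulate a v i))

  -- The companion matrix and its cyclic vector.

  does-toℕ-≟ : ∀ {n} (i j : Fin n) → does (toℕ i ℕₚ.≟ toℕ j) ≡ does (i Finₚ.≟ j)
  does-toℕ-≟ zero    zero    = ≡.refl
  does-toℕ-≟ zero    (suc j) = ≡.refl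
  does-toℕ-≟ (suc i) zero    = ≡.refl
  does-toℕ-≟ (suc i) (suc j) = does-toℕ-≟ i j

  module Companion (l : ℕ) (f : Poly) where

    private
      M : Matrix (suc l) (suc l)
      M = companion (suc l) f

    e₀ : Vector Carrier (suc l)
    e₀ i = Iᴹ i zero

    companion-last : ∀ i → M i (fromℕ l) ≡ - coeff f (toℕ i)
    companion-last i = ≡.cong
      (λ b → if b then - coeff f (toℕ i)
             else if does (toℕ i ℕₚ.≟ suc (toℕ (fromℕ l))) then 1# else 0#)
      (dec-true (suc (toℕ (fromℕ l)) ℕₚ.≟ suc l) (≡.cong suc (Finₚ.toℕ-fromℕ l)))

    companion-inject₁ : ∀ i (j : Fin l) →
      M i (inject₁ j) ≡ (if does (toℕ i ℕₚ.≟ suc (toℕ j)) then 1# else 0#)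
    companion-inject₁ i j = ≡.cong₂
      (λ b t → if b then - coeff f (toℕ i) else if does (toℕ i ℕₚ.≟ suc t) then 1# else 0#)
      (dec-false (suc (toℕ (inject₁ j)) ℕₚ.≟ suc l)
        (λ eq → ℕₚ.<⇒≢ (Finₚ.toℕ<n j) (≡.trans (≡.sym (Finₚ.toℕ-inject₁ j)) (ℕₚ.suc-injective eq))))
      (Finₚ.toℕ-inject₁ j)

    -- Without its last column the companion matrix is a zero row above an identity matrix.
    -- `does-toℕ-≟` matches its test on numbers with the test on indices in `Iᴹ`.
    shift : ∀ h (i : Fin (suc l)) →
            sum (λ j → M i (inject₁ j) *F coeff h (toℕ j)) ≈ coeff (0# ∷ h) (toℕ i)
    shift h zero    = sum-zero _ λ j → trans (*-congʳ (reflexive (companion-inject₁ zero j))) (zeroˡ _)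
    shift h (suc i) = trans
      (sum-cong-≋ λ j → *-congʳ (reflexive (≡.trans (companion-inject₁ (suc i) j)
        (≡.cong (λ b → if b then 1# else 0#) (does-toℕ-≟ i j)))))
      (⟨Iᴹ,⟩ (coeff h ∘ toℕ) i)

    -- Reading vectors as polynomials modulo f, `M` is multiplication by X: the shift gives X h, and
    -- the last column subtracts `coeff h l` times f.
    companion-*ᵛ : ∀ h i → (M *ᵛ (coeff h ∘ toℕ)) i ≈
                   coeff (0# ∷ h) (toℕ i) +F - coeff f (toℕ i) *F coeff h l
    companion-*ᵛ h i = begin
      (M *ᵛ (coeff h ∘ toℕ)) i
        ≈⟨ sum-init-last (λ j → M i j *F coeff h (toℕ j)) ⟩
      sum (λ j → M i (inject₁ j) *F coeff h (toℕ (inject₁ j))) +F M i (fromℕ l) *F coeff h (toℕ (fromℕ l))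
        ≈⟨ +-cong (sum-cong-≋ λ j → *-congˡ {M i (inject₁ j)} (reflexive (≡.cong (coeff h) (Finₚ.toℕ-inject₁ j))))
             (*-cong (reflexive (companion-last i)) (reflexive (≡.cong (coeff h) (Finₚ.toℕ-fromℕ l)))) ⟩
      sum (λ j → M i (inject₁ j) *F coeff h (toℕ j)) +F - coeff f (toℕ i) *F coeff h l
        ≈⟨ +-congʳ (shift h i) ⟩
      coeff (0# ∷ h) (toℕ i) +F - coeff f (toℕ i) *F coeff h l ∎

    open Action M

    coeff-∷ : ∀ a p i → a *F e₀ i +F coeff (0# ∷ p) (toℕ i) ≈ coeff (a ∷ p) (toℕ i)
    coeff-∷ a p zero    = trans (+-identityʳ _) (*-identityʳ a)
    coeff-∷ a p (suc i) = trans (+-congʳ (zeroʳ a)) (+-identityˡ _)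

    -- e₀ stands for the polynomial 1, and below degree ℓ no reduction modulo f takes place. Hence
    -- e₀ is cyclic, and p(M) e₀ = 0 forces p = 0 in this range.
    act-e₀ : ∀ p → DegreeBelow (suc l) p → act M p e₀ ≋ coeff p ∘ toℕ
    -- The bound is on `p`, so `a ∷ p` may reach degree ℓ, as f does; a single overflow term then
    -- remains.
    act-∷-e₀ : ∀ a p → DegreeBelow (suc l) p → ∀ i →
               act M (a ∷ p) e₀ i ≈ coeff (a ∷ p) (toℕ i) +F - coeff f (toℕ i) *F coeff p l

    act-e₀ []      deg i = refl
    act-e₀ (a ∷ p) deg i = begin
      act M (a ∷ p) e₀ i
        ≈⟨ act-∷-e₀ a p (λ j l<j → deg (suc j) (ℕₚ.≤-trans l<j (ℕₚ.n≤1+n j))) i ⟩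
      coeff (a ∷ p) (toℕ i) +F - coeff f (toℕ i) *F coeff p l
        -- Coefficient `l` of `p` is coefficient `suc l` of `a ∷ p`, hence zero: there is no
        -- overflow.
        ≈⟨ +-congˡ (trans (*-congˡ (deg (suc l) ℕₚ.≤-refl)) (zeroʳ _)) ⟩
      coeff (a ∷ p) (toℕ i) +F 0#
        ≈⟨ +-identityʳ _ ⟩
      coeff (a ∷ p) (toℕ i) ∎

    act-∷-e₀ a p deg i = begin
      a *F e₀ i +F (M *ᵛ act M p e₀) i
        ≈⟨ +-congˡ (trans (⟨⟩-congʳ (M i) (act-e₀ p deg)) (companion-*ᵛ p i)) ⟩
      a *F e₀ i +F (coeff (0# ∷ p) (toℕ i) +F - coeff f (toℕ i) *F coeff p l)
        ≈⟨ +-assoc _ _ _ ⟨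
      a *F e₀ i +F coeff (0# ∷ p) (toℕ i) +F - coeff f (toℕ i) *F coeff p l
        ≈⟨ +-congʳ (coeff-∷ a p i) ⟩
      coeff (a ∷ p) (toℕ i) +F - coeff f (toℕ i) *F coeff p l ∎

    act-tabulate-e₀ : ∀ a → act M (List.tabulate a) e₀ ≋ a
    act-tabulate-e₀ a i = trans (act-e₀ (List.tabulate a) (tabulate-degreeBelow a) i) (coeff-tabulate a i)

    module Monic (monic : MonicOfDegree (suc l) f) where

      -- For f = a + X g monic, `coeff g l` is 1, so the overflow term is exactly minus the
      -- coefficients of f. The argument `g ≡ f` permits a case split on the fixed polynomial f.
      act-self-e₀ : ∀ g → g ≡ f → act M g e₀ ≋ 0ᵛ
      act-self-e₀ []      ≡.refl i = refl
      act-self-e₀ (a ∷ g) ≡.refl i = begin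
        act M (a ∷ g) e₀ i
          ≈⟨ act-∷-e₀ a g (λ j l<j → proj₂ monic (suc j) (s≤s l<j)) i ⟩
        coeff f (toℕ i) +F - coeff f (toℕ i) *F coeff g l
          ≈⟨ +-congˡ (trans (*-congˡ (proj₁ monic)) (*-identityʳ _)) ⟩
        coeff f (toℕ i) -F coeff f (toℕ i)
          ≈⟨ -‿inverseʳ _ ⟩
        0# ∎

      -- e₀ is a cyclic vector, so f(M) e₀ = 0 forces f(M) = 0.
      act-self : ∀ v → act M f v ≋ 0ᵛ
      act-self v i = begin
        act M f v i                                ≈⟨ act-congʳ f (act-tabulate-e₀ v) i ⟨
        act M f (act M (List.tabulate v) e₀) i     ≈⟨ act-comm f (List.tabulate v) e₀ i ⟩
        act M (List.tabulate v) (act M f e₀) i     ≈⟨ act-congʳ (List.tabulate v) (act-self-e₀ f ≡.refl) i ⟩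
        act M (List.tabulate v) 0ᵛ i               ≈⟨ act-0ᵛ (List.tabulate v) i ⟩
        0#                                         ∎

      module Domain (irreducible : Irreducible f) (_≈?_ : Decidable _≈_) where

        -- A nonzero g of degree d < deg f with g(M) w = 0 divides f: the
        -- remainder of f by g also kills w, so it vanishes by induction on d.
        annihilator-trivial : ∀ d → d ≤ suc l → ∀ g → DegreeBelow d g →
          ∀ w → ¬ (w ≋ 0ᵛ) → act M g w ≋ 0ᵛ → ∀ i → coeff g i ≈ 0#
        annihilator-trivial zero    _   g deg w w≉0 gw≈0 i = deg i z≤n
        -- Either the bound on `g` drops, or `g` has degree exactly `d` and can serve as a divisor.
        annihilator-trivial (suc d) d<ℓ g deg w w≉0 gw≈0 with coeff g d ≈? 0#
        ... | yes gd≈0 = annihilator-trivial d (ℕₚ.<⇒≤ d<ℓ) g (degreeBelow-pred {p = g} deg gd≈0) w w≉0 gw≈0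
        ... | no  gd≉0 with divide g deg gd≉0 f
        ...   | s , t , t< , f≈ = ⊥-elim (unit-factor (split-∣1 f≈sg))
          where
          open RawSemiringDefinitions.Irreducible irreducible using (split-∣1)

          tw≈0 : act M t w ≋ 0ᵛ
          tw≈0 i = begin
            act M t w i                              ≈⟨ +-identityˡ _ ⟨
            0# +F act M t w i                        ≈⟨ +-congʳ (act-0ᵛ s i) ⟨
            act M s 0ᵛ i +F act M t w i              ≈⟨ +-congʳ (act-congʳ s gw≈0 i) ⟨
            act M s (act M g w) i +F act M t w i     ≈⟨ +-congʳ (act-*ᴾ s g w i) ⟨
            act M (s *ᴾ g) w i +F act M t w i        ≈⟨ act-+ᴾ (s *ᴾ g) t w i ⟨
            act M ((s *ᴾ g) +ᴾ t) w i                ≈⟨ act-congˡ f ((s *ᴾ g) +ᴾ t) w f≈ i ⟨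
            act M f w i                              ≈⟨ act-self w i ⟩
            0#                                       ∎

          f≈sg : f ≈ᴾ (s *ᴾ g)
          f≈sg i = begin
            coeff f i                           ≈⟨ f≈ i ⟩
            coeff ((s *ᴾ g) +ᴾ t) i             ≈⟨ coeff-+ᴾ (s *ᴾ g) t i ⟩
            coeff (s *ᴾ g) i +F coeff t i       ≈⟨ +-congˡ (annihilator-trivial d (ℕₚ.<⇒≤ d<ℓ) t t< w w≉0 tw≈0 i) ⟩
            coeff (s *ᴾ g) i +F 0#              ≈⟨ +-identityʳ _ ⟩
            coeff (s *ᴾ g) i                    ∎

          unit-cancel : ∀ u h v → (u *ᴾ h) ≈ᴾ (1# ∷ []) → act M h v ≋ 0ᵛ → v ≋ 0ᵛ
          unit-cancel u h v uh≈1 hv≈0 i = begin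
            v i                         ≈⟨ act-1ᴾ v i ⟨
            act M (1# ∷ []) v i         ≈⟨ act-congˡ (u *ᴾ h) (1# ∷ []) v uh≈1 i ⟨
            act M (u *ᴾ h) v i          ≈⟨ act-*ᴾ u h v i ⟩
            act M u (act M h v) i       ≈⟨ act-congʳ u hv≈0 i ⟩
            act M u 0ᵛ i                ≈⟨ act-0ᵛ u i ⟩
            0#                          ∎

          sge₀≈0 : act M s (act M g e₀) ≋ 0ᵛ
          sge₀≈0 i = begin
            act M s (act M g e₀) i      ≈⟨ act-*ᴾ s g e₀ i ⟨
            act M (s *ᴾ g) e₀ i         ≈⟨ act-congˡ f (s *ᴾ g) e₀ f≈sg i ⟨
            act M f e₀ i                ≈⟨ act-self e₀ i ⟩
            0#                          ∎

          unit-factor : ¬ (s ∣ᴾ (1# ∷ []) ⊎ g ∣ᴾ (1# ∷ []))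
          -- If `g` is a unit, g(M) is injective, yet it kills the nonzero `w`.
          unit-factor (inj₂ (u , ug≈1)) = w≉0 (unit-cancel u g w ug≈1 gw≈0)
          -- If `s` is a unit, s(M) g(M) e₀ = f(M) e₀ = 0 gives g(M) e₀ = 0. Since d < ℓ, the
          -- leading coefficient of `g` is an entry of this vector.
          unit-factor (inj₁ (u , us≈1)) = gd≉0 (begin
            coeff g d                        ≈⟨ reflexive (≡.cong (coeff g) (Finₚ.toℕ-fromℕ< d<ℓ)) ⟨
            coeff g (toℕ (fromℕ< d<ℓ))       ≈⟨ act-e₀ g (λ i ℓ≤i → deg i (ℕₚ.≤-trans d<ℓ ℓ≤i)) (fromℕ< d<ℓ) ⟨
            act M g e₀ (fromℕ< d<ℓ)          ≈⟨ unit-cancel u s (act M g e₀) us≈1 sge₀≈0 (fromℕ< d<ℓ) ⟩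
            0#                               ∎)

        -- Either q(M) e₀ is zero, and its entries are the coefficients of `q`, or it is a nonzero
        -- vector killed by `p`, to which `annihilator-trivial` applies.
        zero-product : ∀ p q → DegreeBelow (suc l) p → DegreeBelow (suc l) q →
          act M p (act M q e₀) ≋ 0ᵛ → (∀ i → coeff p (toℕ {suc l} i) ≈ 0#) ⊎ (∀ i → coeff q (toℕ {suc l} i) ≈ 0#)
        zero-product p q p< q< pq≈0 with Finₚ.all? (λ i → act M q e₀ i ≈? 0#)
        ... | yes q≈0 = inj₂ λ i → trans (sym (act-e₀ q q< i)) (q≈0 i)
        ... | no  q≉0 = inj₁ λ i → annihilator-trivial (suc l) ℕₚ.≤-refl p p< (act M q e₀) q≉0 pq≈0 (toℕ i)


  -- Orthogonal complements as kernels of matrices in systematic form.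

  -- Orthogonality to the rows suffices, and each row lies in the row space with a unit vector as
  -- coefficients.
  ⊥-generated : ∀ {ℓ n} {W U : Subspace n} {G : Matrix ℓ n} → W ≐ˢ U ⊥ → U ≐ˢ rowSpace G →
                ∀ v → (v ∈ Member W → G *ᵛ v ≋ 0ᵛ) × (G *ᵛ v ≋ 0ᵛ → v ∈ Member W)
  ⊥-generated {G = G} (W⊆ , ⊆W) (U⊆ , ⊆U) v =
    (λ v∈W i → W⊆ v∈W (G i) (⊆U (Iᴹ i , λ j → sym (⟨Iᴹ,⟩ (λ t → G t j) i)))) ,
    (λ Gv≈0 → ⊆W λ u u∈U → let (a , u≈) = U⊆ u∈U in begin
      ⟨ u , v ⟩                          ≈⟨ ⟨⟩-congˡ v u≈ ⟩
      ⟨ linearCombination a G , v ⟩      ≈⟨ ⟨⟩-∑ˡ a G v ⟩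
      ⟨ a , G *ᵛ v ⟩                     ≈⟨ ⟨⟩-congʳ a Gv≈0 ⟩
      ⟨ a , 0ᵛ ⟩                         ≈⟨ ⟨⟩-zeroʳ a ⟩
      0#                                 ∎)

  module Blocks {ℓ m n} (eq : n ≡ ℓ + m) where

    left : Fin ℓ → Fin n
    left i = Fin.cast (≡.sym eq) (i ↑ˡ m)

    right : Fin m → Fin n
    right i = Fin.cast (≡.sym eq) (ℓ ↑ʳ i)

    join : Vector Carrier ℓ → Vector Carrier m → Vector Carrier n
    join x y i = (x ++ y) (Fin.cast eq i)

    join-left : ∀ x y i → join x y (left i) ≡ x i
    join-left x y i = ≡.trans
      (≡.cong (x ++ y) (Finₚ.cast-involutive eq (≡.sym eq) (i ↑ˡ m)))
      (lookup-++ˡ x y i)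

    join-right : ∀ x y i → join x y (right i) ≡ y i
    join-right x y i = ≡.trans
      (≡.cong (x ++ y) (Finₚ.cast-involutive eq (≡.sym eq) (ℓ ↑ʳ i)))
      (lookup-++ʳ x y i)

    block-ext : ∀ {u v : Vector Carrier n} →
                u ∘ left ≋ v ∘ left → u ∘ right ≋ v ∘ right → u ≋ v
    block-ext {u} {v} l≋ r≋ i =
      ≡.subst (λ i → u i ≈ v i) position (split (Fin.splitAt ℓ (Fin.cast eq i)))
      where
      position : Fin.cast (≡.sym eq) (Fin.join ℓ m (Fin.splitAt ℓ (Fin.cast eq i))) ≡ i
      position = ≡.trans (≡.cong (Fin.cast (≡.sym eq)) (Finₚ.join-splitAt ℓ m (Fin.cast eq i)))
                         (Finₚ.cast-involutive (≡.sym eq) eq i)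

      split : ∀ s → u (Fin.cast (≡.sym eq) (Fin.join ℓ m s)) ≈ v (Fin.cast (≡.sym eq) (Fin.join ℓ m s))
      split (inj₁ i) = l≋ i
      split (inj₂ i) = r≋ i

    ⟨⟩-blocks : ∀ u v → ⟨ u , v ⟩ ≈ ⟨ u ∘ left , v ∘ left ⟩ +F ⟨ u ∘ right , v ∘ right ⟩
    ⟨⟩-blocks u v = trans (sum-cast eq (λ i → u i *F v i))
      (sum-++ ℓ (λ i → u (Fin.cast (≡.sym eq) i) *F v (Fin.cast (≡.sym eq) i)))

    module Systematic (P : Matrix ℓ m) where

      systematic : Matrix ℓ n
      systematic i = join (Iᴹ i) (P i)

      systematic-*ᵛ : ∀ v i → (systematic *ᵛ v) i ≈ v (left i) +F (P *ᵛ (v ∘ right)) i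
      systematic-*ᵛ v i = begin
        ⟨ systematic i , v ⟩
          ≈⟨ ⟨⟩-blocks (systematic i) v ⟩
        ⟨ systematic i ∘ left , v ∘ left ⟩ +F ⟨ systematic i ∘ right , v ∘ right ⟩
          ≈⟨ +-cong (⟨⟩-congˡ (v ∘ left) λ j → reflexive (join-left (Iᴹ i) (P i) j))
                    (⟨⟩-congˡ (v ∘ right) λ j → reflexive (join-right (Iᴹ i) (P i) j)) ⟩
        ⟨ Iᴹ i , v ∘ left ⟩ +F (P *ᵛ (v ∘ right)) i
          ≈⟨ +-congʳ (⟨Iᴹ,⟩ (v ∘ left) i) ⟩
        v (left i) +F (P *ᵛ (v ∘ right)) i ∎

      -- The matrix [-Pᵀ ∣ I] of coding theory, whose rows form a basis of the kernel of [I ∣ P].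
      parityCheck : Matrix m n
      parityCheck i = join (λ t → - P t i) (Iᴹ i)

      parityCheck-left : ∀ a t → linearCombination a parityCheck (left t) ≈ - (P *ᵛ a) t
      parityCheck-left a t = begin
        sum (λ i → a i *F parityCheck i (left t))
          ≈⟨ sum-cong-≋ (λ i → *-congˡ (reflexive (join-left (λ t → - P t i) (Iᴹ i) t))) ⟩
        sum (λ i → a i *F - P t i)
          ≈⟨ sum-cong-≋ (λ i → trans (sym (-‿distribʳ-* (a i) (P t i)))
               (trans (-‿cong (*-comm (a i) (P t i))) (sym (-1*x≈-x (P t i *F a i))))) ⟩
        sum (λ i → - 1# *F (P t i *F a i))
          ≈⟨ *-distribˡ-sum (- 1#) (λ i → P t i *F a i) ⟨
        - 1# *F (P *ᵛ a) t
          ≈⟨ -1*x≈-x _ ⟩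
        - (P *ᵛ a) t ∎

      parityCheck-right : ∀ a t → linearCombination a parityCheck (right t) ≈ a t
      parityCheck-right a t = begin
        sum (λ i → a i *F parityCheck i (right t))
          ≈⟨ sum-cong-≋ (λ i → *-congˡ (reflexive (join-right (λ t → - P t i) (Iᴹ i) t))) ⟩
        ⟨ a , (λ i → Iᴹ i t) ⟩
          ≈⟨ ⟨,Iᴹ⟩ a t ⟩
        a t ∎

      -- The right block of a kernel vector is free and serves as its coordinates; the left block is
      -- then forced to be -P times it.
      kernel-dimension : ∀ {k} → m ≡ k → (W : Subspace n) →
        (∀ v → (v ∈ Member W → systematic *ᵛ v ≋ 0ᵛ) × (systematic *ᵛ v ≋ 0ᵛ → v ∈ Member W)) →
        HasDimension k W
      kernel-dimension ≡.refl W W-kernel =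
        parityCheck ,
        (λ a a≈0 t → trans (sym (parityCheck-right a t)) (a≈0 (right t))) ,
        (λ {v} v∈W → v ∘ right , block-ext
          (λ i → trans
            (inverseˡ-unique _ _ (trans (sym (systematic-*ᵛ v i)) (proj₁ (W-kernel v) v∈W i)))
            (sym (parityCheck-left (v ∘ right) i)))
          (λ i → sym (parityCheck-right (v ∘ right) i))) ,
        (λ {v} (a , v≈) → proj₂ (W-kernel v) λ i → begin
          (systematic *ᵛ v) i
            ≈⟨ systematic-*ᵛ v i ⟩
          v (left i) +F (P *ᵛ (v ∘ right)) i
            ≈⟨ +-cong (trans (v≈ (left i)) (parityCheck-left a i))
                 (⟨⟩-congʳ (P i) λ t → trans (v≈ (right t)) (parityCheck-right a t)) ⟩
          - (P *ᵛ a) i +F (P *ᵛ a) i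
            ≈⟨ -‿inverseˡ _ ⟩
          0# ∎)


  -- T² - (A + B) T + AB at a root T: x is an entry of AB e₀ and y the same entry of T² e₀.
  x+[-[x+y]+y]≈0 : ∀ x y → x +F (- (x +F y) +F y) ≈ 0#
  x+[-[x+y]+y]≈0 x y = begin
    x +F (- (x +F y) +F y)     ≈⟨ x∙yz≈y∙xz x _ y ⟩
    - (x +F y) +F (x +F y)     ≈⟨ -‿inverseˡ _ ⟩
    0#                         ∎

  -- (T - A)(T - B) multiplied out, with a, b, c, d in the places of BA, TA, BT, T² applied to e₀;
  -- the right-hand side has the shape of `equations`.
  product-expansion : ∀ a b c d → (d -F c) -F (b -F a) ≈ a +F (- (b +F c) +F d)
  product-expansion a b c d = begin
    (d -F c) -F (b -F a)           ≈⟨ +-congˡ (⁻¹-anti-homo‿- b a) ⟩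
    (d -F c) +F (a -F b)           ≈⟨ solve 4 (λ a b′ c′ d → (d ⊕ c′) ⊕ (a ⊕ b′) ⊜ a ⊕ ((b′ ⊕ c′) ⊕ d)) refl a (- b) (- c) d ⟩
    a +F ((- b +F - c) +F d)       ≈⟨ +-congˡ (+-congʳ (⁻¹-∙-comm b c)) ⟩
    a +F (- (b +F c) +F d)         ∎
    where open CommutativeMonoidSolver +-commutativeMonoid using (solve; _⊕_; _⊜_)

  -- The dual family: equations, dimension, sunflowers and size.

  module DualFamily {l n : ℕ} (1≤ℓ : 1 ≤ suc l) (n≥ : n ≥ 2 * suc l + 1)
                    (f : Poly) (monic : MonicOfDegree (suc l) f)
                    (irreducible : Irreducible f) (_≈?_ : Decidable _≈_) where

    private
      ℓ w : ℕ
      ℓ = suc l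
      w = n ∸ (2 * ℓ + 1)

      M : Matrix ℓ ℓ
      M = companion ℓ f

      𝓕 : Family n (lsuc (c ⊔ r))
      𝓕 = ℱ 1≤ℓ n≥ f

    open Companion l f
    open Monic monic
    open Domain irreducible _≈?_
    open Action M
    open Blocks {ℓ} {ℓ + suc w} (blockWidths ℓ n n≥)

    -- A v for the matrix A of `𝒞` with coefficient vector a, without forming A.
    evalᵛ : Vector Carrier ℓ → Vector Carrier ℓ → Vector Carrier ℓ
    evalᵛ a = act M (List.tabulate a)

    evalᵛ-cong : ∀ {a b} v → a ≋ b → evalᵛ a v ≋ evalᵛ b v
    evalᵛ-cong {a} {b} v a≋b = act-congˡ (List.tabulate a) (List.tabulate b) v (tabulate-cong a≋b)

    equations : Vector Carrier ℓ → Vector Carrier n → Vector Carrier ℓ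
    equations a v i =
      v (left i) +F (evalᵛ a (v ∘ right ∘ (_↑ˡ suc w)) i
                      +F evalᵛ a (evalᵛ a e₀) i *F v (right (ℓ ↑ʳ zero)))

    generator-*ᵛ : ∀ {A} (A∈𝒞 : A ∈ 𝒞 ℓ f) v → generator 1≤ℓ n≥ A *ᵛ v ≋ equations (proj₁ A∈𝒞) v
    generator-*ᵛ {A} (a , A≈) v i = begin
      (generator 1≤ℓ n≥ A *ᵛ v) i
        ≈⟨ Systematic.systematic-*ᵛ P v i ⟩
      v (left i) +F ⟨ P i , u ⟩
        ≈⟨ +-congˡ (sum-++ ℓ {suc w} (λ j → P i j *F u j)) ⟩
      v (left i) +F (sum (λ (j : Fin ℓ) → P i (j ↑ˡ suc w) *F u (j ↑ˡ suc w)) +F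
                     sum (λ j → P i (ℓ ↑ʳ j) *F u (ℓ ↑ʳ j)))
        ≈⟨ +-congˡ (+-cong
             (trans (⟨⟩-congˡ (u ∘ (_↑ˡ suc w)) λ j → reflexive (lookup-++ˡ (A i) (Q i) j)) (A*ᵛ (u ∘ (_↑ˡ suc w)) i))
             (trans (⟨⟩-congˡ (u ∘ (ℓ ↑ʳ_)) λ j → reflexive (lookup-++ʳ (A i) (Q i) j)) (Q*ᵛ (u ∘ (ℓ ↑ʳ_))))) ⟩
      equations a v i ∎
      where
      Q = firstColumn 1≤ℓ (A *ᴹ A) ∣∣ 0ᴹ {n = w}
      P = A ∣∣ Q
      u = v ∘ right

      A*ᵛ : ∀ x → A *ᵛ x ≋ evalᵛ a x
      A*ᵛ x i = trans (⟨⟩-congˡ x (A≈ i)) (span-*ᵛ a x i)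

      -- The first column of A is A e₀, so that of A² is A (A e₀).
      A²-column : (A *ᴹ A) i zero ≈ evalᵛ a (evalᵛ a e₀) i
      A²-column = begin
        ⟨ A i , (λ j → A j zero) ⟩      ≈⟨ ⟨⟩-congʳ (A i) (λ j → trans (sym (⟨,Iᴹ⟩ (A j) zero)) (A*ᵛ e₀ j)) ⟩
        ⟨ A i , evalᵛ a e₀ ⟩            ≈⟨ A*ᵛ (evalᵛ a e₀) i ⟩
        evalᵛ a (evalᵛ a e₀) i          ∎

      Q*ᵛ : ∀ y → ⟨ Q i , y ⟩ ≈ evalᵛ a (evalᵛ a e₀) i *F y zero
      Q*ᵛ y = trans (+-cong (*-congʳ A²-column) (sum-zero _ λ j → zeroˡ (y (suc j)))) (+-identityʳ _)

    Dual : Set (lsuc (c ⊔ r))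
    Dual = ∃[ W ] W ∈ 𝓕

    Point : Dual → Pred (Vector Carrier n) (c ⊔ r)
    Point (W , _) = Member W

    -- Read off the membership proof, so a priori dependent on the choice of U and A; by
    -- `coefficients-unique` the subspace alone determines it.
    coefficients : Dual → Vector Carrier ℓ
    coefficients (_ , _ , (_ , (a , _) , _) , _) = a

    dual-equations : ∀ V v →
      (v ∈ Point V → equations (coefficients V) v ≋ 0ᵛ) ×
      (equations (coefficients V) v ≋ 0ᵛ → v ∈ Point V)
    dual-equations (W , U , (A , A∈𝒞 , U≐) , W≐) v =
      (λ v∈W i → trans (sym (generator-*ᵛ A∈𝒞 v i)) (proj₁ kernel v∈W i)) ,
      (λ eqs → proj₂ kernel λ i → trans (generator-*ᵛ A∈𝒞 v i) (eqs i))
      where kernel = ⊥-generated {W = W} {U = U} W≐ U≐ v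

    𝓕-dimension : 𝓕 ⊆ HasDimension (n ∸ ℓ)
    𝓕-dimension {W} (U , (A , A∈𝒞 , U≐) , W≐) = Systematic.kernel-dimension
      (A ∣∣ firstColumn 1≤ℓ (A *ᴹ A) ∣∣ 0ᴹ)
      (≡.sym (≡.trans (≡.cong (_∸ ℓ) (blockWidths ℓ n n≥)) (ℕₚ.m+n∸m≡n ℓ _)))
      W (⊥-generated {W = W} {U = U} W≐ U≐)

    coefficients-determine : ∀ V W → coefficients V ≋ coefficients W → Point V ≐ Point W
    coefficients-determine V W a≋b = ⊆-by V W a≋b , ⊆-by W V (sym ∘ a≋b)
      where
      ⊆-by : ∀ V W → coefficients V ≋ coefficients W → Point V ⊆ Point W
      ⊆-by V W a≋b {v} v∈V = proj₂ (dual-equations W v) λ i → trans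
        (+-congˡ (+-cong (evalᵛ-cong _ (sym ∘ a≋b) i)
          (*-congʳ (trans (evalᵛ-cong _ (sym ∘ a≋b) i)
                     (act-congʳ (List.tabulate (coefficients V)) (evalᵛ-cong e₀ (sym ∘ a≋b)) i)))))
        (proj₁ (dual-equations V v) v∈V i)

    point : Vector Carrier ℓ → Vector Carrier ℓ → Carrier → Vector Carrier n
    point x y z = join x (y ++ (λ (_ : Fin 1) → z) ++ 0ᵛ {w})

    equations-point : ∀ a x y z i →
      equations a (point x y z) i ≈ x i +F (evalᵛ a y i +F evalᵛ a (evalᵛ a e₀) i *F z)
    equations-point a x y z i = +-cong (reflexive (join-left x _ i)) (+-cong
      (act-congʳ (List.tabulate a) (λ j → reflexive
        (≡.trans (join-right x _ (j ↑ˡ suc w)) (lookup-++ˡ y _ j))) i)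
      (*-congˡ (reflexive (≡.trans (join-right x _ (ℓ ↑ʳ zero)) (lookup-++ʳ y _ zero)))))

    -- The point (-a, e₀, 0, 0) lies in the first complement because A e₀ = a; its membership in the
    -- second says B e₀ = a, that is, b = a.
    coefficients-unique : ∀ V W → Point V ⊆ Point W → coefficients V ≋ coefficients W
    coefficients-unique V W V⊆W i = sym (x∙y⁻¹≈ε⇒x≈y (b i) (a i) (trans (+-comm _ _)
      (trans (sym (equations-v b i)) (proj₁ (dual-equations W v) (V⊆W v∈V) i))))
      where
      a = coefficients V
      b = coefficients W
      v = point (λ i → - a i) e₀ 0#

      equations-v : ∀ d i → equations d v i ≈ - a i +F d i
      equations-v d i = trans (equations-point d _ e₀ 0# i)
        (+-congˡ (trans (+-cong (act-tabulate-e₀ d i) (zeroʳ _)) (+-identityʳ _)))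

      v∈V : v ∈ Point V
      v∈V = proj₂ (dual-equations V v) λ i → trans (equations-v a i) (-‿inverseˡ (a i))

    ∩-⊆ : ∀ V₁ V₂ V₃ →
      (∀ v → v ∈ Point V₁ → v ∈ Point V₂ → v ∈ Point V₃) →
      coefficients V₃ ≋ coefficients V₁ ⊎ coefficients V₃ ≋ coefficients V₂
    ∩-⊆ V₁ V₂ V₃ ∩⊆ = Sum.map equal equal
      (zero-product (t -ᴾ p) (t -ᴾ q) (difference-degree a₃ a₁) (difference-degree a₃ a₂) λ i → begin
        act M (t -ᴾ p) (act M (t -ᴾ q) e₀) i
          ≈⟨ act--ᴾ t p _ i ⟩
        act M t (act M (t -ᴾ q) e₀) i -F act M p (act M (t -ᴾ q) e₀) i
          -- `act--ᴾ` expands only the outer polynomial, so the factors are swapped to bring the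
          -- inner difference outside.
          ≈⟨ +-cong (trans (act-comm t (t -ᴾ q) e₀ i) (act--ᴾ t q _ i))
               (-‿cong (trans (act-comm p (t -ᴾ q) e₀ i) (act--ᴾ t q _ i))) ⟩
        (act M t (act M t e₀) i -F act M q (act M t e₀) i) -F (act M t (act M p e₀) i -F act M q (act M p e₀) i)
          ≈⟨ product-expansion _ _ _ _ ⟩
        act M q (act M p e₀) i +F (- (act M t (act M p e₀) i +F act M q (act M t e₀) i) +F act M t (act M t e₀) i)
          ≈⟨ +-cong (act-comm q p e₀ i) (+-congʳ (-‿cong (+-congˡ (act-comm q t e₀ i)))) ⟩
        act M p (act M q e₀) i +F (- (act M t (act M p e₀) i +F act M t (act M q e₀) i) +F act M t (act M t e₀) i)
          ≈⟨ equations-v a₃ i ⟨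
        equations a₃ v i
          ≈⟨ proj₁ (dual-equations V₃ v) (∩⊆ v v∈V₁ v∈V₂) i ⟩
        0# ∎)
      where
      a₁ = coefficients V₁
      a₂ = coefficients V₂
      a₃ = coefficients V₃
      p  = List.tabulate a₁
      q  = List.tabulate a₂
      t  = List.tabulate a₃
      v  = point (act M p (act M q e₀)) (- 1# ·ᵛ (act M p e₀ +ᵛ act M q e₀)) 1#

      equations-v : ∀ d i → let s = List.tabulate d in equations d v i ≈
        act M p (act M q e₀) i +F
        (- (act M s (act M p e₀) i +F act M s (act M q e₀) i) +F act M s (act M s e₀) i)
      equations-v d i = trans (equations-point d _ _ 1# i) (+-congˡ (+-cong
        (trans (act-·ᵛ s (- 1#) _ i) (trans (-1*x≈-x _) (-‿cong (act-+ᵛ s _ _ i))))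
        (*-identityʳ _)))
        where s = List.tabulate d

      v∈V₁ : v ∈ Point V₁
      v∈V₁ = proj₂ (dual-equations V₁ v) λ i → trans (equations-v a₁ i)
        (trans (+-congˡ (+-congʳ (-‿cong (+-comm _ _)))) (x+[-[x+y]+y]≈0 _ _))

      v∈V₂ : v ∈ Point V₂
      v∈V₂ = proj₂ (dual-equations V₂ v) λ i → trans (equations-v a₂ i)
        (trans (+-congʳ (act-comm p q e₀ i)) (x+[-[x+y]+y]≈0 _ _))

      difference-degree : ∀ a b → DegreeBelow ℓ (List.tabulate a -ᴾ List.tabulate b)
      difference-degree a b = -ᴾ-degreeBelow (List.tabulate a) (List.tabulate b)
        (tabulate-degreeBelow a) (tabulate-degreeBelow b)

      equal : ∀ {a b : Vector Carrier ℓ} →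
              (∀ i → coeff (List.tabulate a -ᴾ List.tabulate b) (toℕ {ℓ} i) ≈ 0#) → a ≋ b
      equal {a} {b} a-b≈0 i = x∙y⁻¹≈ε⇒x≈y (a i) (b i) (trans
        (sym (+-cong (coeff-tabulate a i) (-‿cong (coeff-tabulate b i))))
        (trans (sym (coeff--ᴾ (List.tabulate a) (List.tabulate b) (toℕ i))) (a-b≈0 i)))

    sunflower-free : ∀ s → 3 ≤ s → SetLikeSunflowerFree (n ∸ ℓ) s 𝓕
    -- Three petals already give the contradiction. A vector common to petals 0 and 1 lies in the
    -- kernel `K`, hence in petal 2.
    sunflower-free _ (s≤s (s≤s (s≤s _))) (S , S∈𝓕 , K , sunflower) =
      [ (λ c≋a → distinct 2F 0F (λ ()) (coefficients-determine (V 2F) (V 0F) c≋a))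
      , (λ c≋b → distinct 2F 1F (λ ()) (coefficients-determine (V 2F) (V 1F) c≋b))
      ]′ (∩-⊆ (V 0F) (V 1F) (V 2F) λ v v∈S₀ v∈S₁ →
           proj₂ (proj₁ (kernel 0F 2F (λ ())) (proj₂ (kernel 0F 1F (λ ())) (v∈S₀ , v∈S₁))))
      where
      open IsSetLikeSunflower sunflower

      V : Fin _ → Dual
      V i = S i , S∈𝓕 i

    fromCoefficients : Vector Carrier ℓ → Dual
    fromCoefficients a = U ⊥ , U , (A , (a , λ _ _ → refl) , ≐-refl) , ≐-refl
      where
      A = λ i j → sum (λ t → a t *F (M ^ᴹ toℕ t) i j)
      U = rowSpace (generator 1≤ℓ n≥ A)

    -- Coefficient vectors biject with the family: `coefficients-unique` makes the encoding respect
    -- equality of subspaces, and `coefficients-determine` makes decoding recover the subspace.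
    𝓕-size : ∀ {q} → HasCardinality setoid q → HasSize 𝓕 (q ^ ℓ)
    𝓕-size {q} card = record
      { to        = encode
      ; from      = decode
      ; to-cong   = λ {V} {W} → encode-cong V W
      ; from-cong = λ { ≡.refl → ≐-refl }
      ; inverse   =
          (λ {x} {V} V≐ → ≡.trans (encode-cong V (decode x) V≐) (encode-decode x)) ,
          (λ { {V} ≡.refl → coefficients-determine (decode (encode V)) V (decode-encode V) })
      }
      where
      module Card = Inverse card

      encode : Dual → Fin (q ^ ℓ)
      encode V = Fin.funToFin (λ i → Card.to (coefficients V i))

      decode : Fin (q ^ ℓ) → Dual
      decode x = fromCoefficients (λ i → Card.from (Fin.finToFun x i))

      encode-cong : ∀ V W → Point V ≐ Point W → encode V ≡ encode W
      encode-cong V W (V⊆W , _) =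
        funToFin-cong λ i → Card.to-cong (coefficients-unique V W V⊆W i)

      encode-decode : ∀ x → encode (decode x) ≡ x
      encode-decode x = ≡.trans
        (funToFin-cong {ℓ} λ i → Card.strictlyInverseˡ (Fin.finToFun x i))
        (Finₚ.funToFin-finToFin {ℓ} {q} x)

      decode-encode : ∀ V → coefficients (decode (encode V)) ≋ coefficients V
      decode-encode V i = trans
        (reflexive (≡.cong Card.from (Finₚ.finToFun-funToFin (λ i → Card.to (coefficients V i)) i)))
        (Card.strictlyInverseʳ (coefficients V i))

mainTheorem1 :
    ∀ {c r} (q : ℕ) → IsPrimePower q →
    (F : Field c r) → HasCardinality (Field.setoid F) q →
    let open OverField F in
    (ℓ n : ℕ) (1≤ℓ : 1 ≤ ℓ) (n≥2ℓ+1 : n ≥ 2 * ℓ + 1) →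
    (f : Poly) → MonicOfDegree ℓ f → Irreducible f →
    let k = n ∸ ℓ
        𝓕 = ℱ 1≤ℓ n≥2ℓ+1 f
    in (𝓕 ⊆ HasDimension k)
     × HasSize 𝓕 (q ^ ℓ)
     × (q ^ ℓ ≡ q ^ (n ∸ k))
     × (∀ s → 3 ≤ s → SetLikeSunflowerFree k s 𝓕)
mainTheorem1 q _ F card (suc l) n 1≤ℓ n≥ f monic irreducible =
  (λ {W} → 𝓕-dimension {W}) , 𝓕-size card , ≡.cong (q ^_) (≡.sym (ℕₚ.m∸[m∸n]≡n ℓ≤n)) , sunflower-free
  where
  -- A bijection with `Fin q` makes equality in the field decidable, which the case splits on
  -- vanishing coefficients and vectors require.
  _≈?_ : Decidable (Field._≈_ F)
  _≈?_ = via-injection (Inverse⇒Injection card) Finₚ._≟_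

  ℓ≤n : suc l ≤ n
  ℓ≤n = ℕₚ.≤-trans (ℕₚ.≤-trans (ℕₚ.m≤m+n (suc l) (suc l + 0)) (ℕₚ.m≤m+n (2 * suc l) 1)) n≥

  open LinearAlgebra.DualFamily F 1≤ℓ n≥ f monic irreducible _≈?_
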